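{- For all $h,g\in\mathcal{Q}$ such that $h\gg g$, there is some $f\in\mathcal{Q}$ such that $h\gg f\gg g$.
   Context: $\mathcal{Q}$ is the collection of nondecreasing computable functions $h\colon\omega\to[2,\omega)$ satisfying $h(n)\ge 2^n$ for all $n$. For $h\in\mathcal{Q}$ let $h^{(1)}=h$ and $h^{(k+1)}=h\circ h^{(k)}$. For $h,g\in\mathcal{Q}$, $h\gg g$ ("$h$ dominates the iterates of $g$ uniformly") means there is a computable sequence $(d_k)_{k\ge1}$ such that for all $k\ge 1$, $h(n)\ge g^{(k)}(n)$ for all $n>d_k$. -}

module Defs where

open import Data.Nat using (ℕ; zero; suc; _≤_; _<_; _^_)
open import Data.Product using (Σ; _×_)

InQ : (ℕ → ℕ) → Set
InQ h = (∀ m n → m ≤ n → h m ≤ h n) × (∀ n → 2 ≤ h n) × (∀ n → 2 ^ n ≤ h n)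

iter : (ℕ → ℕ) → ℕ → ℕ → ℕ
iter h zero    n = n
iter h (suc k) n = h (iter h k n)

_≫_ : (ℕ → ℕ) → (ℕ → ℕ) → Set
h ≫ g = Σ (ℕ → ℕ) λ d → ∀ k → 1 ≤ k → ∀ n → d k < n → iter g k n ≤ h n

module Submission where

-- Given h ≫ g with witness d, we build f = λ n → g^(ℓ(n)+1)(n), where the
-- "level" ℓ(n) is the largest j with e(j) ≤ n for a fast strictly
-- increasing sequence e with e(0) = 0.  Since ℓ(n) ≥ k once n > e(k),
-- f eventually exceeds every fixed iterate g^k, so f ≫ g.  Conversely e is
-- chosen so fast that, when ℓ(n) = j,
--   (i)  the orbit of f from n stays below e(j+2), where f ≤ g^(j+2), hence
--        f^k(n) ≤ g^(k(j+2))(n) for k ≤ j+1;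
--   (ii) n ≥ e(j) exceeds the thresholds d(k(j+2)) for all k ≤ j, hence
--        g^(k(j+2))(n) ≤ h(n);
-- which together give h ≫ f with witness e.

open import Defs
open import Data.Nat using (ℕ; zero; suc; _+_; _*_; _^_; _≤_; _<_; z≤n; s≤s; _≤?_; _∸_)
open import Data.Nat.Properties
open import Data.Product using (Σ; _×_; _,_; proj₁; proj₂)
open import Data.Sum using (inj₁; inj₂)
open import Relation.Nullary using (yes; no)
open import Relation.Binary.PropositionalEquality using (_≡_; refl; sym; cong; subst)

n<2^n : ∀ n → n < 2 ^ n
n<2^n zero    = s≤s z≤n
n<2^n (suc n) = +-mono-≤ (m^n>0 2 n) (subst (suc n ≤_) (sym (+-identityʳ (2 ^ n))) (n<2^n n))

InQ⇒inflationary : ∀ {g} → InQ g → ∀ x → x ≤ g x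
InQ⇒inflationary (_ , _ , g-exp) x = ≤-trans (<⇒≤ (n<2^n x)) (g-exp x)

iter-+ : ∀ (g : ℕ → ℕ) a c n → iter g (a + c) n ≡ iter g a (iter g c n)
iter-+ g zero    c n = refl
iter-+ g (suc a) c n = cong g (iter-+ g a c n)

module Iteration (g : ℕ → ℕ) (g-mono : ∀ m n → m ≤ n → g m ≤ g n)
                 (g-infl : ∀ x → x ≤ g x) where

  iter-monoʳ : ∀ a {x y} → x ≤ y → iter g a x ≤ iter g a y
  iter-monoʳ zero    x≤y = x≤y
  iter-monoʳ (suc a) x≤y = g-mono _ _ (iter-monoʳ a x≤y)

  iter-infl : ∀ a x → x ≤ iter g a x
  iter-infl zero    x = ≤-refl
  iter-infl (suc a) x = ≤-trans (iter-infl a x) (g-infl (iter g a x))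

  iter-monoˡ : ∀ {a b} x → a ≤ b → iter g a x ≤ iter g b x
  iter-monoˡ {a} {b} x a≤b =
    subst (λ c → iter g a x ≤ iter g c x) (m∸n+n≡m a≤b)
      (subst (iter g a x ≤_) (sym (iter-+ g (b ∸ a) a x)) (iter-infl (b ∸ a) (iter g a x)))

  iter-mono : ∀ {a b x y} → a ≤ b → x ≤ y → iter g a x ≤ iter g b y
  iter-mono {a} {y = y} a≤b x≤y = ≤-trans (iter-monoʳ a x≤y) (iter-monoˡ y a≤b)

  -- Orbit comparison: if f ≤ g^c below a bound B, and g^(m·c)(n) < B, then
  -- the first m iterates of f at n are bounded by those of g^c, because the
  -- comparison keeps the f-orbit below B.
  orbit-bound : ∀ (f : ℕ → ℕ) c B n m →
    (∀ x → x < B → f x ≤ iter g c x) → iter g (m * c) n < B →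
    ∀ i → i ≤ m → iter f i n ≤ iter g (i * c) n
  orbit-bound f c B n m f-below orbit<B zero    _   = ≤-refl
  orbit-bound f c B n m f-below orbit<B (suc i) i<m =
    begin
      f (iter f i n)               ≤⟨ f-below _ (≤-<-trans ih (≤-<-trans (iter-monoˡ n i·c≤m·c) orbit<B)) ⟩
      iter g c (iter f i n)        ≤⟨ iter-monoʳ c ih ⟩
      iter g c (iter g (i * c) n)  ≡⟨ sym (iter-+ g c (i * c) n) ⟩
      iter g (suc i * c) n         ∎
    where
    open ≤-Reasoning
    ih : iter f i n ≤ iter g (i * c) n
    ih = orbit-bound f c B n m f-below orbit<B i (<⇒≤ i<m)
    i·c≤m·c : i * c ≤ m * c
    i·c≤m·c = *-monoˡ-≤ c (<⇒≤ i<m)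

runningSum : (ℕ → ℕ) → ℕ → ℕ
runningSum d zero    = d zero
runningSum d (suc N) = d (suc N) + runningSum d N

runningSum-bound : ∀ d {i N} → i ≤ N → d i ≤ runningSum d N
runningSum-bound d {N = zero}  z≤n = ≤-refl
runningSum-bound d {N = suc N} i≤N with m≤n⇒m<n∨m≡n i≤N
... | inj₁ i<1+N = ≤-trans (runningSum-bound d (≤-pred i<1+N)) (m≤n+m _ (d (suc N)))
... | inj₂ refl  = m≤m+n (d (suc N)) _

module Level (e : ℕ → ℕ) (e-zero : e 0 ≡ 0) (e-step : ∀ m → e m < e (suc m)) where

  e-mono : ∀ {a b} → a ≤ b → e a ≤ e b
  e-mono {b = zero}  z≤n = ≤-refl
  e-mono {b = suc b} a≤b with m≤n⇒m<n∨m≡n a≤b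
  ... | inj₁ a<1+b = ≤-trans (e-mono (≤-pred a<1+b)) (<⇒≤ (e-step b))
  ... | inj₂ refl  = ≤-refl

  e-reflects-< : ∀ {a b} → e a < e b → a < b
  e-reflects-< ea<eb = ≰⇒> (λ b≤a → <⇒≱ ea<eb (e-mono b≤a))

  -- Moving from n to n+1 the level rises by one exactly when the next term
  -- of e is reached; e increases by at least one per step, so this suffices.
  level : ℕ → ℕ
  level zero = 0
  level (suc n) with e (suc (level n)) ≤? suc n
  ... | yes _ = suc (level n)
  ... | no  _ = level n

  level-bracket : ∀ n → e (level n) ≤ n × n < e (suc (level n))
  level-bracket zero = subst (_≤ 0) (sym e-zero) ≤-refl , subst (_< e 1) e-zero (e-step 0)
  level-bracket (suc n) with e (suc (level n)) ≤? suc n | level-bracket n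
  ... | yes reached | _ , n<e  = reached , ≤-<-trans n<e (e-step _)
  ... | no  missed  | e≤n , _  = m≤n⇒m≤1+n e≤n , ≰⇒> missed

  level-low : ∀ n → e (level n) ≤ n
  level-low n = proj₁ (level-bracket n)

  level-high : ∀ n → n < e (suc (level n))
  level-high n = proj₂ (level-bracket n)

  level-max : ∀ {i n} → e i ≤ n → i ≤ level n
  level-max {i} {n} ei≤n = ≮⇒≥ (λ level<i → <⇒≱ (level-high n) (≤-trans (e-mono level<i) ei≤n))

  level-mono : ∀ {m n} → m ≤ n → level m ≤ level n
  level-mono {m} m≤n = level-max (≤-trans (level-low m) m≤n)

  level-below : ∀ {x j} → x < e j → level x < j
  level-below {x} x<ej = e-reflects-< (≤-<-trans (level-low x) x<ej)

module Interpolant (h g : ℕ → ℕ) (gQ : InQ g) (d : ℕ → ℕ)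
                   (h≫g : ∀ k → 1 ≤ k → ∀ n → d k < n → iter g k n ≤ h n) where

  open Iteration g (proj₁ gQ) (InQ⇒inflationary gQ)

  -- e(m+1) exceeds g^(m(m+1))(e(m)), which drives (i), and the thresholds
  -- d(i) for i ≤ (m+1)(m+3), which drives (ii).
  e : ℕ → ℕ
  e zero    = 0
  e (suc m) = suc (iter g (m * suc m) (e m) + runningSum d (suc m * suc (suc (suc m))))

  e-step : ∀ m → e m < e (suc m)
  e-step m = s≤s (≤-trans (iter-infl (m * suc m) (e m)) (m≤m+n _ _))

  open Level e refl e-step

  f : ℕ → ℕ
  f n = iter g (suc (level n)) n

  f-InQ : InQ f
  f-InQ = (λ m n m≤n → iter-mono (s≤s (level-mono m≤n)) m≤n)
        , (λ n → proj₁ (proj₂ gQ) _)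
        , (λ n → ≤-trans (proj₂ (proj₂ gQ) n) (iter-monoˡ {b = suc (level n)} n (s≤s z≤n)))

  -- Below e(j+1) the level is at most j, so f ≤ g^(j+1) there.
  f-below : ∀ j x → x < e (suc j) → f x ≤ iter g (suc j) x
  f-below j x x<e = iter-monoˡ x (level-below {x} {suc j} x<e)

  f-orbit : ∀ n i → i ≤ suc (level n) → iter f i n ≤ iter g (i * suc (suc (level n))) n
  f-orbit n = orbit-bound f c (e (suc (suc j))) n (suc j) (f-below (suc j)) orbit<e
    where
    j = level n
    c = suc (suc j)
    orbit<e : iter g (suc j * c) n < e (suc (suc j))
    orbit<e = s≤s (≤-trans (iter-monoʳ (suc j * c) (<⇒≤ (level-high n))) (m≤m+n _ _))

  threshold : ∀ j → 1 ≤ j → ∀ k → k ≤ j → d (k * suc (suc j)) < e j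
  threshold (suc m) _ k k≤j =
    ≤-<-trans (runningSum-bound d (*-monoˡ-≤ (suc (suc (suc m))) k≤j)) (s≤s (m≤n+m _ (iter g (m * suc m) (e m))))

  f≫g : f ≫ g
  f≫g = e , λ k _ n ek<n → iter-monoˡ n (m≤n⇒m≤1+n (level-max (<⇒≤ ek<n)))

  h≫f : h ≫ f
  h≫f = e , λ k 1≤k n ek<n →
    let k≤j = level-max (<⇒≤ ek<n)
        c   = suc (suc (level n))
    in ≤-trans (f-orbit n k (m≤n⇒m≤1+n k≤j))
               (h≫g (k * c) (*-mono-≤ 1≤k (s≤s z≤n)) n
                    (<-≤-trans (threshold (level n) (≤-trans 1≤k k≤j) k k≤j) (level-low n)))

lemma1p6 : (h g : ℕ → ℕ) → InQ h → InQ g → h ≫ g →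
    Σ (ℕ → ℕ) λ f → InQ f × (h ≫ f) × (f ≫ g)
lemma1p6 h g _ gQ (d , h≫g) = f , f-InQ , h≫f , f≫g
  where open Interpolant h g gQ d h≫g
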